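{- Let $L$ be the regular language over $\{0,1\}$ given by the regular expression \[ L = 1 + 011 + 110 + 11(01)^*\Bigl[00 + 00(11)^+ + (11)^+00 + (11)^*1011 + 1101(11)^*\Bigr](10)^*11 + 11(01)^*(11)^*01 + 10(11)^*(10)^*11 . \] Then a one-dimensional Peg Solitaire configuration $w\in\{0,1\}^*$ can be reduced to a configuration with exactly one peg if and only if $w \in 0^*L0^*$. In particular, the set of configurations reducible to a single peg is a regular language.
   Context: One-dimensional Peg Solitaire: a configuration is a finite word $w=c_0c_1\cdots c_{n-1}\in\{0,1\}^*$, describing a row of $n$ consecutive sites, where $c_i=1$ means site $i$ holds a peg and $c_i=0$ means site $i$ is a hole. The board consists exactly of these $n$ sites (no sites outside the word may be used). A move (hop) takes three consecutive sites $i,i+1,i+2$ (all within the board) such that one end site and the middle site hold pegs and the other end site is a hole, moves the end peg to the hole, and removes the peg from the middle site (i.e. $110\to001$ or $011\to100$ on those three sites). A configuration can be reduced to one peg if some sequence of hops leads to a configuration with exactly one peg. In regular expressions, $+$ denotes union, $u^*$ denotes zero or more repetitions of $u$, $u^+=uu^*$, and concatenation is juxtaposition. -}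

module Defs where

open import Level using (0ℓ)
open import Data.Bool.Base using (Bool; true; false)
open import Data.Bool.Properties using (_≟_; ≤-decTotalOrder)
open import Data.List.Base using (List; []; _∷_; _++_; length; filter)
open import Data.Nat.Base using (ℕ)
open import Data.Product.Base using (∃-syntax; _×_)
open import Function.Bundles using (_⇔_)
open import Relation.Binary.Bundles using (DecTotalOrder)
open import Relation.Binary.Construct.Closure.ReflexiveTransitive using (Star)
open import Relation.Binary.PropositionalEquality.Core using (_≡_)
open import Relation.Unary using (Pred)

-- The order on Bool is only used by the library to interpret character
-- ranges; none occur below.
open import Text.Regex.Base (DecTotalOrder.preorder ≤-decTotalOrder) public
  using (Exp; ε; _∣_; _∙_; _⋆; singleton; _∈_)

Config : Set
Config = List Bool

-- The letters 1 (peg) and 0 (hole).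
pattern ● = true
pattern ○ = false

infix 4 _⟶_ _⟶*_

data _⟶_ : Config → Config → Set where
  hopʳ : ∀ u v → u ++ ● ∷ ● ∷ ○ ∷ v ⟶ u ++ ○ ∷ ○ ∷ ● ∷ v
  hopˡ : ∀ u v → u ++ ○ ∷ ● ∷ ● ∷ v ⟶ u ++ ● ∷ ○ ∷ ○ ∷ v

_⟶*_ : Config → Config → Set
_⟶*_ = Star _⟶_

pegs : Config → ℕ
pegs w = length (filter (_≟ ●) w)

ReducibleToOnePeg : Pred Config 0ℓ
ReducibleToOnePeg w = ∃[ w′ ] (w ⟶* w′) × (pegs w′ ≡ 1)

Regular : Pred (List Bool) 0ℓ → Set
Regular P = ∃[ e ] (∀ w → P w ⇔ w ∈ e)

𝟎 𝟏 : Exp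
𝟎 = singleton ○
𝟏 = singleton ●

infixl 7 _⁺

_⁺ : Exp → Exp
e ⁺ = e ∙ e ⋆

-- Precedence, tightest first: _⋆ and _⁺, then _∙_ (concatenation),
-- then _∣_ (union).
L : Exp
L = 𝟏
  ∣ 𝟎 ∙ 𝟏 ∙ 𝟏
  ∣ 𝟏 ∙ 𝟏 ∙ 𝟎
  ∣ 𝟏 ∙ 𝟏 ∙ (𝟎 ∙ 𝟏) ⋆
      ∙ ( 𝟎 ∙ 𝟎
        ∣ 𝟎 ∙ 𝟎 ∙ (𝟏 ∙ 𝟏) ⁺
        ∣ (𝟏 ∙ 𝟏) ⁺ ∙ 𝟎 ∙ 𝟎
        ∣ (𝟏 ∙ 𝟏) ⋆ ∙ 𝟏 ∙ 𝟎 ∙ 𝟏 ∙ 𝟏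
        ∣ 𝟏 ∙ 𝟏 ∙ 𝟎 ∙ 𝟏 ∙ (𝟏 ∙ 𝟏) ⋆
        )
      ∙ (𝟏 ∙ 𝟎) ⋆ ∙ 𝟏 ∙ 𝟏
  ∣ 𝟏 ∙ 𝟏 ∙ (𝟎 ∙ 𝟏) ⋆ ∙ (𝟏 ∙ 𝟏) ⋆ ∙ 𝟎 ∙ 𝟏
  ∣ 𝟏 ∙ 𝟎 ∙ (𝟏 ∙ 𝟏) ⋆ ∙ (𝟏 ∙ 𝟎) ⋆ ∙ 𝟏 ∙ 𝟏

{-# OPTIONS --safe #-}

-- Both directions are regular-language inclusions, settled by a finite check.
-- Let E = 0*L0*.  Its Brzozowski derivatives, simplified by the library's smart
-- constructors, form a deterministic automaton with 28 states.
-- (⇒) A one-peg word lies in E, and E is closed under inverse hops: if state p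
-- is reached from q by 001 and r by 110 then ⟦p⟧ ⊆ ⟦r⟧, and likewise for 100
-- and 011.
-- (⇐) Every word of E has exactly one peg or admits a hop that stays in E; hops
-- decrease the number of pegs.
-- The inclusions have the form ⟦q⟧ ⊆ ⋃ S with S a set of states of a
-- nondeterministic automaton, and they follow from a set of such pairs (q , S)
-- that is closed under reading a letter.
module Submission where

open import Defs
open import Data.Bool.Base using (Bool; if_then_else_)
open import Data.Bool.Properties using (_≟_; ≤-decTotalOrder)
open import Data.Fin using (Fin; #_)
open import Data.Fin.Patterns using (0F)
import Data.Fin.Properties as Fin
open import Data.List.Base using (List; []; _∷_; _++_; allFin; concatMap; deduplicate; filter; foldl; length; map)
open import Data.List.Membership.Propositional using (find; lose) renaming (_∈_ to _∈ₗ_)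
open import Data.List.Membership.Propositional.Properties using (∈-allFin)
open import Data.List.Properties using (filter-++; length-++; ≡-dec)
open import Data.List.Relation.Binary.Equality.Propositional using (≋-refl)
open import Data.List.Relation.Ternary.Appending.Propositional using ([]++_; _∷_)
open import Data.List.Relation.Unary.All as All using (All; []; _∷_; all?)
open import Data.List.Relation.Unary.Any as Any using (Any; here; there; any?)
open import Data.List.Relation.Unary.Any.Properties using (concatMap⁻)
open import Data.Nat.Base using (ℕ; zero; suc; _+_)
import Data.Nat.Properties as ℕ
open import Data.Product.Base using (_×_; _,_; proj₁; proj₂; ∃-syntax)
open import Data.Sum.Base using (inj₁; inj₂)
open import Data.Vec.Base as Vec using (Vec; []; _∷_)
open import Function.Base using (_∘_; flip)
open import Function.Bundles using (_⇔_; mk⇔)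
open import Relation.Binary.Bundles using (DecTotalOrder)
open import Relation.Binary.Construct.Closure.ReflexiveTransitive using (ε; _◅_)
open import Relation.Binary.Definitions using (DecidableEquality)
open import Relation.Binary.PropositionalEquality using (_≡_; refl; sym; trans; cong; cong₂; subst)
open import Relation.Nullary.Decidable using (Dec; no; does; map′; from-yes; _×-dec_; _→-dec_)
open import Relation.Nullary.Negation using (¬_; contradiction)
open import Text.Regex.Base (DecTotalOrder.preorder ≤-decTotalOrder) using ([_]; sum; prod; star)
open import Text.Regex.Derivative.Brzozowski (DecTotalOrder.decPoset ≤-decTotalOrder) using (eat; eat-sound; eat-complete)
open import Text.Regex.Properties (DecTotalOrder.decPoset ≤-decTotalOrder) using ([]∈?_)

-- The derivative automaton of `E`

E : Exp
E = 𝟎 ⋆ ∙ L ∙ 𝟎 ⋆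

State : Set
State = Fin 28

-- The row of q holds the shortest word leading to q and the successors of q
-- under 0 and 1.
table : Vec (Config × State × State) 28
table =
  ([]                             , # 1  , # 2 ) ∷
  (○ ∷ []                         , # 1  , # 3 ) ∷
  (● ∷ []                         , # 4  , # 5 ) ∷
  (○ ∷ ● ∷ []                     , # 4  , # 6 ) ∷
  (● ∷ ○ ∷ []                     , # 7  , # 8 ) ∷
  (● ∷ ● ∷ []                     , # 9  , # 10) ∷
  (○ ∷ ● ∷ ● ∷ []                 , # 11 , # 10) ∷
  (● ∷ ○ ∷ ○ ∷ []                 , # 7  , # 12) ∷
  (● ∷ ○ ∷ ● ∷ []                 , # 13 , # 14) ∷
  (● ∷ ● ∷ ○ ∷ []                 , # 15 , # 16) ∷
  (● ∷ ● ∷ ● ∷ []                 , # 17 , # 18) ∷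
  (○ ∷ ● ∷ ● ∷ ○ ∷ []             , # 19 , # 16) ∷
  (● ∷ ○ ∷ ○ ∷ ● ∷ []             , # 12 , # 12) ∷
  (● ∷ ○ ∷ ● ∷ ○ ∷ []             , # 12 , # 20) ∷
  (● ∷ ○ ∷ ● ∷ ● ∷ []             , # 7  , # 8 ) ∷
  (● ∷ ● ∷ ○ ∷ ○ ∷ []             , # 7  , # 8 ) ∷
  (● ∷ ● ∷ ○ ∷ ● ∷ []             , # 21 , # 10) ∷
  (● ∷ ● ∷ ● ∷ ○ ∷ []             , # 12 , # 22) ∷
  (● ∷ ● ∷ ● ∷ ● ∷ []             , # 23 , # 24) ∷
  (○ ∷ ● ∷ ● ∷ ○ ∷ ○ ∷ []         , # 25 , # 8 ) ∷
  (● ∷ ○ ∷ ● ∷ ○ ∷ ● ∷ []         , # 13 , # 7 ) ∷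
  (● ∷ ● ∷ ○ ∷ ● ∷ ○ ∷ []         , # 15 , # 16) ∷
  (● ∷ ● ∷ ● ∷ ○ ∷ ● ∷ []         , # 12 , # 13) ∷
  (● ∷ ● ∷ ● ∷ ● ∷ ○ ∷ []         , # 13 , # 14) ∷
  (● ∷ ● ∷ ● ∷ ● ∷ ● ∷ []         , # 17 , # 26) ∷
  (○ ∷ ● ∷ ● ∷ ○ ∷ ○ ∷ ○ ∷ []     , # 25 , # 12) ∷
  (● ∷ ● ∷ ● ∷ ● ∷ ● ∷ ● ∷ []     , # 27 , # 24) ∷
  (● ∷ ● ∷ ● ∷ ● ∷ ● ∷ ● ∷ ○ ∷ [] , # 13 , # 7 ) ∷ []

⟦_⟧ : State → Exp
⟦ q ⟧ = foldl (flip eat) E (proj₁ (Vec.lookup table q))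

δ : State → Bool → State
δ q ○ = proj₁ (proj₂ (Vec.lookup table q))
δ q ● = proj₂ (proj₂ (Vec.lookup table q))

run : State → Config → State
run = foldl δ

Derivatives : State → Set
Derivatives q = eat ○ ⟦ q ⟧ ≡ ⟦ δ q ○ ⟧ × eat ● ⟦ q ⟧ ≡ ⟦ δ q ● ⟧

-- Each `refl` evaluates a derivative and finds it syntactically equal to the expression of the
-- tabulated successor, so no further state arises.
derivatives : All Derivatives (allFin 28)
derivatives =
  (refl , refl) ∷ (refl , refl) ∷ (refl , refl) ∷ (refl , refl) ∷
  (refl , refl) ∷ (refl , refl) ∷ (refl , refl) ∷ (refl , refl) ∷
  (refl , refl) ∷ (refl , refl) ∷ (refl , refl) ∷ (refl , refl) ∷
  (refl , refl) ∷ (refl , refl) ∷ (refl , refl) ∷ (refl , refl) ∷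
  (refl , refl) ∷ (refl , refl) ∷ (refl , refl) ∷ (refl , refl) ∷
  (refl , refl) ∷ (refl , refl) ∷ (refl , refl) ∷ (refl , refl) ∷
  (refl , refl) ∷ (refl , refl) ∷ (refl , refl) ∷ (refl , refl) ∷ []

eat-⟦⟧ : ∀ c q → eat c ⟦ q ⟧ ≡ ⟦ δ q c ⟧
eat-⟦⟧ ○ q = proj₁ (All.lookup derivatives (∈-allFin q))
eat-⟦⟧ ● q = proj₂ (All.lookup derivatives (∈-allFin q))

∈-δ⁻ : ∀ q {c v} → c ∷ v ∈ ⟦ q ⟧ → v ∈ ⟦ δ q c ⟧
∈-δ⁻ q {c} {v} = subst (v ∈_) (eat-⟦⟧ c q) ∘ eat-complete c ⟦ q ⟧

∈-δ⁺ : ∀ q {c v} → v ∈ ⟦ δ q c ⟧ → c ∷ v ∈ ⟦ q ⟧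
∈-δ⁺ q {c} {v} = eat-sound c ⟦ q ⟧ ∘ subst (v ∈_) (sym (eat-⟦⟧ c q))

∈-run⁻ : ∀ q u {v} → u ++ v ∈ ⟦ q ⟧ → v ∈ ⟦ run q u ⟧
∈-run⁻ q []      = λ m → m
∈-run⁻ q (c ∷ u) = ∈-run⁻ (δ q c) u ∘ ∈-δ⁻ q

∈-run⁺ : ∀ q u {v} → v ∈ ⟦ run q u ⟧ → u ++ v ∈ ⟦ q ⟧
∈-run⁺ q []      = λ m → m
∈-run⁺ q (c ∷ u) = ∈-δ⁺ q ∘ ∈-run⁺ (δ q c) u

-- Hops and the number of pegs

∷-⟶ : ∀ c {v v′} → v ⟶ v′ → c ∷ v ⟶ c ∷ v′
∷-⟶ c (hopʳ u v) = hopʳ (c ∷ u) v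
∷-⟶ c (hopˡ u v) = hopˡ (c ∷ u) v

pegs-++ : ∀ u v → pegs (u ++ v) ≡ pegs u + pegs v
pegs-++ u v = trans (cong length (filter-++ (_≟ ●) u v)) (length-++ (filter (_≟ ●) u))

pegs-⟶ : ∀ {v v′} → v ⟶ v′ → pegs v ≡ suc (pegs v′)
pegs-⟶ (hopʳ u v) rewrite pegs-++ u (● ∷ ● ∷ ○ ∷ v) | pegs-++ u (○ ∷ ○ ∷ ● ∷ v) = ℕ.+-suc (pegs u) _
pegs-⟶ (hopˡ u v) rewrite pegs-++ u (○ ∷ ● ∷ ● ∷ v) | pegs-++ u (● ∷ ○ ∷ ○ ∷ v) = ℕ.+-suc (pegs u) _

-- The nondeterministic automaton

infix 6 _▹_

-- The item `u ▹ q` arises when a hop is guessed: `u` is the unread rest of its pattern, and `q` has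
-- already read the three letters that the hop leaves behind.
data Item : Set where
  exactly : ℕ → Item
  hop     : State → Item
  _▹_     : Config → State → Item

Lang : Item → Config → Set
Lang (exactly k) v = pegs v ≡ k
Lang (hop q)     v = ∃[ v′ ] (v ⟶ v′) × v′ ∈ ⟦ q ⟧
Lang (u ▹ q)     v = ∃[ v′ ] v ≡ u ++ v′ × v′ ∈ ⟦ q ⟧

-- From hop q, the hop either starts at the letter just read or comes later.
step : Bool → Item → List Item
step ○ (exactly k)       = exactly k ∷ []
step ● (exactly zero)    = []
step ● (exactly (suc k)) = exactly k ∷ []
step ○ (hop q)           = hop (δ q ○) ∷ (● ∷ ● ∷ []) ▹ run q (● ∷ ○ ∷ ○ ∷ []) ∷ []
step ● (hop q)           = hop (δ q ●) ∷ (● ∷ ○ ∷ []) ▹ run q (○ ∷ ○ ∷ ● ∷ []) ∷ []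
step c ([] ▹ q)          = [] ▹ δ q c ∷ []
step ○ ((○ ∷ u) ▹ q)     = u ▹ q ∷ []
step ● ((● ∷ u) ▹ q)     = u ▹ q ∷ []
step ○ ((● ∷ u) ▹ q)     = []
step ● ((○ ∷ u) ▹ q)     = []

-- Items stand on the right of an inclusion, so acceptance after `c` is traced back to before it. A
-- later hop survives prepending `c`; a matched rest of a pattern yields the hop starting at `c`.
step-sound : ∀ c i {v} → Any (λ j → Lang j v) (step c i) → Lang i (c ∷ v)
step-sound ○ (exactly k)       (here p) = p
step-sound ● (exactly (suc k)) (here p) = cong suc p
step-sound ○ (hop q) (here (_ , h , m)) = _ , ∷-⟶ ○ h , ∈-δ⁺ q m
step-sound ● (hop q) (here (_ , h , m)) = _ , ∷-⟶ ● h , ∈-δ⁺ q m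
step-sound ○ (hop q) (there (here (v , refl , m))) = _ , hopˡ [] v , ∈-run⁺ q (● ∷ ○ ∷ ○ ∷ []) m
step-sound ● (hop q) (there (here (v , refl , m))) = _ , hopʳ [] v , ∈-run⁺ q (○ ∷ ○ ∷ ● ∷ []) m
step-sound ○ ([] ▹ q) (here (_ , refl , m)) = _ , refl , ∈-δ⁺ q m
step-sound ● ([] ▹ q) (here (_ , refl , m)) = _ , refl , ∈-δ⁺ q m
step-sound ○ ((○ ∷ u) ▹ q) (here (_ , eq , m)) = _ , cong (○ ∷_) eq , m
step-sound ● ((● ∷ u) ▹ q) (here (_ , eq , m)) = _ , cong (● ∷_) eq , m

[]-irreducible : ∀ {v} → ¬ ([] ⟶ v)
[]-irreducible h = ℕ.0≢1+n (pegs-⟶ h)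

nullable? : ∀ i → Dec (Lang i [])
nullable? (exactly k)   = 0 ℕ.≟ k
nullable? (hop q)       = no λ (_ , h , _) → []-irreducible h
nullable? ([] ▹ q)      = map′ (λ m → [] , refl , m) (λ { (_ , refl , m) → m }) ([]∈? ⟦ q ⟧)
nullable? ((_ ∷ _) ▹ q) = no λ ()

infix 4 _≟ᵢ_

_≟ᵢ_ : DecidableEquality Item
exactly k ≟ᵢ exactly l = map′ (cong exactly) (λ { refl → refl }) (k ℕ.≟ l)
hop p     ≟ᵢ hop q     = map′ (cong hop) (λ { refl → refl }) (p Fin.≟ q)
(u ▹ p)   ≟ᵢ (v ▹ q)   =
  map′ (λ (eq , eq′) → cong₂ _▹_ eq eq′) (λ { refl → refl , refl }) (≡-dec _≟_ u v ×-dec p Fin.≟ q)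
exactly _ ≟ᵢ hop _     = no λ ()
exactly _ ≟ᵢ _ ▹ _     = no λ ()
hop _     ≟ᵢ exactly _ = no λ ()
hop _     ≟ᵢ _ ▹ _     = no λ ()
_ ▹ _     ≟ᵢ exactly _ = no λ ()
_ ▹ _     ≟ᵢ hop _     = no λ ()

-- Inclusions and closed sets of them

Inclusion : Set
Inclusion = State × List Item

Holds : Inclusion → Set
Holds (q , S) = ∀ v → v ∈ ⟦ q ⟧ → Any (λ i → Lang i v) S

derive : Bool → Inclusion → Inclusion
derive c (q , S) = δ q c , concatMap (step c) S

-- A smaller right side makes a stronger inclusion, so the first pair implies the second. Order and
-- repetitions in the lists are immaterial.
Covers : Inclusion → Inclusion → Set
Covers (p , S) (q , T) = q ≡ p × All (_∈ₗ T) S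

covers? : ∀ I J → Dec (Covers I J)
covers? (p , S) (q , T) = q Fin.≟ p ×-dec all? (λ i → any? (i ≟ᵢ_) T) S

Covered : List Inclusion → Inclusion → Set
Covered C J = Any (λ I → Covers I J) C

covered? : ∀ C J → Dec (Covered C J)
covered? C J = any? (λ I → covers? I J) C

Closed : List Inclusion → Inclusion → Set
Closed C I@(q , S) =
  ([] ∈ ⟦ q ⟧ → Any (λ i → Lang i []) S) × Covered C (derive ○ I) × Covered C (derive ● I)

closed? : ∀ C I → Dec (Closed C I)
closed? C I@(q , S) =
  ([]∈? ⟦ q ⟧ →-dec any? nullable? S) ×-dec covered? C (derive ○ I) ×-dec covered? C (derive ● I)

-- Induction on the word: reading a letter leads to a derived inclusion, again covered by `C`, and
-- to a shorter word.
closed⇒holds : ∀ {C} → All (Closed C) C → ∀ {J} → Covered C J → Holds J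
closed⇒holds closed cov v m with find cov
... | (q , S) , I∈C , refl , S⊆T =
  let i , i∈S , l = find (included v m) in lose (All.lookup S⊆T i∈S) l
  where
  included : ∀ v → v ∈ ⟦ q ⟧ → Any (λ i → Lang i v) S
  included v m with All.lookup closed I∈C
  included []      m | null , _ , _ = null m
  included (○ ∷ v) m | _ , cov○ , _ = Any.map (step-sound ○ _)
    (concatMap⁻ (step ○) (closed⇒holds closed cov○ v (∈-δ⁻ q m)))
  included (● ∷ v) m | _ , _ , cov● = Any.map (step-sound ● _)
    (concatMap⁻ (step ●) (closed⇒holds closed cov● v (∈-δ⁻ q m)))

-- The inclusions to be checked

reduction : Inclusion
reduction = 0F , exactly 1 ∷ hop 0F ∷ []

-- The prefix before a hop matters only through the state `q` it leads to, so finitely many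
-- inclusions handle hops in all contexts.
inverseʳ inverseˡ : State → Inclusion
inverseʳ q = run q (○ ∷ ○ ∷ ● ∷ []) , [] ▹ run q (● ∷ ● ∷ ○ ∷ []) ∷ []
inverseˡ q = run q (● ∷ ○ ∷ ○ ∷ []) , [] ▹ run q (○ ∷ ● ∷ ● ∷ []) ∷ []

-- The number is fuel.  Nothing is proved about explore: its result is validated
-- by certificate-closed.
explore : ℕ → List Inclusion → List Inclusion → List Inclusion
explore zero    _               C = C
explore (suc n) []              C = C
explore (suc n) (I@(q , S) ∷ W) C =
  if does (covered? C I) then explore n W C
  else explore n (next ○ ∷ next ● ∷ W) (I ∷ C)
  where
  next : Bool → Inclusion
  next c = δ q c , deduplicate _≟ᵢ_ (concatMap (step c) S)

certificate : List Inclusion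
certificate = explore 300 (reduction ∷ map inverseʳ (allFin 28) ++ map inverseˡ (allFin 28)) []

abstract
  certificate-closed : All (Closed certificate) certificate
  certificate-closed = from-yes (all? (closed? certificate) certificate)

  reduction-covered : Covered certificate reduction
  reduction-covered = from-yes (covered? certificate reduction)

  inverseʳ-covered : ∀ q → Covered certificate (inverseʳ q)
  inverseʳ-covered = from-yes (Fin.all? (covered? certificate ∘ inverseʳ))

  inverseˡ-covered : ∀ q → Covered certificate (inverseˡ q)
  inverseˡ-covered = from-yes (Fin.all? (covered? certificate ∘ inverseˡ))

-- The two directions

E⇒reducible : ∀ n w → pegs w ≡ n → w ∈ E → ReducibleToOnePeg w
E⇒reducible n w eq m with closed⇒holds certificate-closed reduction-covered w m
... | here one = w , ε , one
-- The induction is on the number of pegs, as a hop keeps the length of the word. Without pegs there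
-- is no hop.
E⇒reducible zero    w eq m | there (here (w′ , h , m′)) =
  contradiction (trans (sym eq) (pegs-⟶ h)) ℕ.0≢1+n
E⇒reducible (suc n) w eq m | there (here (w′ , h , m′)) =
  let w″ , hs , one = E⇒reducible n w′ (ℕ.suc-injective (trans (sym (pegs-⟶ h)) eq)) m′
  in w″ , h ◅ hs , one

E-⟶⁻ : ∀ {w w′} → w ⟶ w′ → w′ ∈ E → w ∈ E
E-⟶⁻ (hopʳ u v) m = ∈-run⁺ 0F u (∈-run⁺ q (● ∷ ● ∷ ○ ∷ []) v∈)
  where
  q = run 0F u
  v∈ : v ∈ ⟦ run q (● ∷ ● ∷ ○ ∷ []) ⟧
  v∈ with closed⇒holds certificate-closed (inverseʳ-covered q) v
            (∈-run⁻ q (○ ∷ ○ ∷ ● ∷ []) (∈-run⁻ 0F u m))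
  ... | here (_ , refl , m′) = m′
E-⟶⁻ (hopˡ u v) m = ∈-run⁺ 0F u (∈-run⁺ q (○ ∷ ● ∷ ● ∷ []) v∈)
  where
  q = run 0F u
  v∈ : v ∈ ⟦ run q (○ ∷ ● ∷ ● ∷ []) ⟧
  v∈ with closed⇒holds certificate-closed (inverseˡ-covered q) v
            (∈-run⁻ q (● ∷ ○ ∷ ○ ∷ []) (∈-run⁻ 0F u m))
  ... | here (_ , refl , m′) = m′

letter : ∀ c → c ∷ [] ∈ singleton c
letter c = [ here [ refl ] ]

no-peg⇒𝟎⋆ : ∀ w → pegs w ≡ 0 → w ∈ 𝟎 ⋆
no-peg⇒𝟎⋆ []      eq = star (sum (inj₁ ε))
no-peg⇒𝟎⋆ (○ ∷ w) eq = star (sum (inj₂ (prod (refl ∷ []++ ≋-refl) (letter ○) (no-peg⇒𝟎⋆ w eq))))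

-- Holes before the peg go into the first `𝟎 ⋆`, the peg matches the alternative `𝟏` of `L`, and the
-- holes after it form the last `𝟎 ⋆`.
one-peg⇒E : ∀ w → pegs w ≡ 1 → w ∈ E
one-peg⇒E (○ ∷ w) eq with one-peg⇒E w eq
... | prod app zs rest = prod (refl ∷ app) (star (sum (inj₂ (prod (refl ∷ []++ ≋-refl) (letter ○) zs)))) rest
one-peg⇒E (● ∷ w) eq =
  prod ([]++ ≋-refl) (star (sum (inj₁ ε)))
    (prod (refl ∷ []++ ≋-refl) (sum (inj₁ (letter ●))) (no-peg⇒𝟎⋆ w (ℕ.suc-injective eq)))

reducible⇒E : ∀ w → ReducibleToOnePeg w → w ∈ E
reducible⇒E w (.w , ε      , one) = one-peg⇒E w one
reducible⇒E w (w″ , h ◅ hs , one) = E-⟶⁻ h (reducible⇒E _ (w″ , hs , one))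

theorem1 : ((w : Config) → ReducibleToOnePeg w ⇔ w ∈ 𝟎 ⋆ ∙ L ∙ 𝟎 ⋆) × Regular ReducibleToOnePeg
theorem1 = characterisation , E , characterisation
  where
  characterisation : ∀ w → ReducibleToOnePeg w ⇔ w ∈ E
  characterisation w = mk⇔ (reducible⇒E w) (E⇒reducible (pegs w) w refl)
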